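{- Let $n\geq 3$ and let $k\in\mathbb{Z}_n$ with $k\neq 0$ and $2k\not\equiv 0\pmod n$. Let $C$ be a subset of the vertex set of $\mathrm{GP}(n,k)$. Then $C$ is a total perfect code in $\mathrm{GP}(n,k)$ if and only if one of the following holds: (i) $n\equiv 0\pmod 3$, $k\not\equiv 0\pmod 3$, and $C=C_j:=\{u_{3i+j},v_{3i+j}\mid i\in\mathbb{Z}_n\}$ for some $j\in\{0,1,2\}$; (ii) $n\equiv 0\pmod 6$, $k\equiv \pm 1\pmod 6$, and $C=C'_j:=\{u_{6i+j},u_{6i+j+1},v_{6i+j+3},v_{6i+j+4}\mid i\in\mathbb{Z}_n\}$ for some $j\in\{0,1,2,3,4,5\}$ (all indices modulo $n$).
   Context: For an integer $n\geq 3$ and a nonzero $k\in\mathbb{Z}_n$, the generalized Petersen graph $\mathrm{GP}(n,k)$ is the simple graph with vertex set $\{u_i,v_i\mid i\in\mathbb{Z}_n\}$ and edges $u_iu_{i+1}$, $u_iv_i$, $v_iv_{i+k}$ for all $i\in\mathbb{Z}_n$ (indices modulo $n$). Standing assumption: $2k\not\equiv 0\pmod n$, so that $\mathrm{GP}(n,k)$ is 3-regular. Congruences of $k$ modulo divisors of $n$ are well defined. A total perfect code in a graph $\Gamma$ is a set $C\subseteq V(\Gamma)$ such that every vertex of $\Gamma$ (whether in $C$ or not) is adjacent to exactly one vertex of $C$. -}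

module Defs where

open import Data.Fin.Base using (Fin; toℕ)
open import Data.Fin.Properties using (toℕ-fromℕ<; toℕ<n)
open import Data.Nat.Base
  using (ℕ; _+_; _*_; _∸_; _≤_; _<_; NonZero; s≤s; z≤n)
open import Data.Nat.DivMod using (_mod_; _%_; m%n<n; m<n⇒m%n≡m; m≤n⇒[n∸m]%m≡n%m)
open import Data.Nat.Properties
  using (_<?_; ≮⇒≥; <-irrefl; <-trans; m<m+n; n≢0⇒n>0; +-monoʳ-<;
         +-cancelʳ-<; m∸n+n≡m)
open import Data.Product using (_×_; ∃!)
open import Level using (0ℓ)
open import Relation.Binary.Construct.Closure.Symmetric
  using (SymClosure; fwd; bwd; symmetric)
open import Relation.Binary.Core using (Rel)
open import Relation.Binary.Definitions using (Symmetric; Irreflexive)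
open import Relation.Binary.PropositionalEquality
  using (_≡_; _≢_; refl; sym; trans; cong; subst)
open import Relation.Nullary using (¬_; yes; no)
open import Relation.Unary using (Pred)

record SimpleGraph : Set₁ where
  infix 4 _~_
  field
    V        : Set
    _~_      : Rel V 0ℓ
    ~-sym    : Symmetric _~_
    ~-irrefl : Irreflexive _≡_ _~_

TotalPerfectCode : ∀ {ℓ} (Γ : SimpleGraph) → Pred (SimpleGraph.V Γ) ℓ → Set ℓ
TotalPerfectCode Γ C = ∀ x → ∃! _≡_ (λ y → C y × x ~ y)
  where open SimpleGraph Γ

-- ℤₙ is represented by the residues Fin n; indices are computed in ℕ and
-- then reduced modulo n.

infixl 6 _⊕_

_⊕_ : ∀ {n} .{{_ : NonZero n}} → Fin n → ℕ → Fin n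
_⊕_ {n} i m = (toℕ i + m) mod n

⊕-no-fix : ∀ {n} .{{_ : NonZero n}} (i : Fin n) {d} → 0 < d → d < n → i ≢ i ⊕ d
⊕-no-fix {n} i {d} 0<d d<n eq with toℕ i + d <? n
... | yes lt = <-irrefl (trans toℕ-eq (m<n⇒m%n≡m lt)) (m<m+n (toℕ i) 0<d)
  where
  toℕ-eq : toℕ i ≡ (toℕ i + d) % n
  toℕ-eq = trans (cong toℕ eq) (toℕ-fromℕ< (m%n<n (toℕ i + d) n))
... | no ≮n = <-irrefl (sym toℕ-eq) wrapped<i
  where
  n≤ : n ≤ toℕ i + d
  n≤ = ≮⇒≥ ≮n

  wrapped<i : toℕ i + d ∸ n < toℕ i
  wrapped<i = +-cancelʳ-< n _ _
    (subst (_< toℕ i + n) (sym (m∸n+n≡m n≤)) (+-monoʳ-< (toℕ i) d<n))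

  toℕ-eq : toℕ i ≡ toℕ i + d ∸ n
  toℕ-eq = trans (cong toℕ eq)
    (trans (toℕ-fromℕ< (m%n<n (toℕ i + d) n))
    (trans (sym (m≤n⇒[n∸m]%m≡n%m n≤))
           (m<n⇒m%n≡m (<-trans wrapped<i (toℕ<n i)))))

data Vertex (n : ℕ) : Set where
  u v : Fin n → Vertex n

data Edge (n : ℕ) .{{_ : NonZero n}} (k : Fin n) : Rel (Vertex n) 0ℓ where
  outer : ∀ i → Edge n k (u i) (u (i ⊕ 1))
  spoke : ∀ i → Edge n k (u i) (v i)
  inner : ∀ i → Edge n k (v i) (v (i ⊕ toℕ k))

u-injective : ∀ {n} {i j : Fin n} → u i ≡ u j → i ≡ j
u-injective refl = refl

v-injective : ∀ {n} {i j : Fin n} → v i ≡ v j → i ≡ j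
v-injective refl = refl

Edge-irrefl : ∀ {n} .{{_ : NonZero n}} {k : Fin n} → 3 ≤ n → toℕ k ≢ 0 →
              ∀ {x y} → x ≡ y → ¬ Edge n k x y
Edge-irrefl (s≤s (s≤s _)) _ eq (outer i) =
  ⊕-no-fix i (s≤s z≤n) (s≤s (s≤s z≤n)) (u-injective eq)
Edge-irrefl _ _ () (spoke i)
Edge-irrefl {k = k} _ k≢0 eq (inner i) =
  ⊕-no-fix i (n≢0⇒n>0 k≢0) (toℕ<n k) (v-injective eq)

GP : (n : ℕ) .{{_ : NonZero n}} → 3 ≤ n → (k : Fin n) → toℕ k ≢ 0 → SimpleGraph
GP n 3≤n k k≢0 = record
  { V        = Vertex n
  ; _~_      = SymClosure (Edge n k)
  ; ~-sym    = symmetric (Edge n k)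
  ; ~-irrefl = λ { eq (fwd e) → Edge-irrefl 3≤n k≢0 eq e
                 ; eq (bwd e) → Edge-irrefl 3≤n k≢0 (sym eq) e }
  }

-- The sets C_j and C'_j, named C₃ and C₆ after their periods.

data C₃ (n : ℕ) .{{_ : NonZero n}} (j : Fin 3) : Pred (Vertex n) 0ℓ where
  u₀ : ∀ (i : Fin n) → C₃ n j (u ((3 * toℕ i + toℕ j) mod n))
  v₀ : ∀ (i : Fin n) → C₃ n j (v ((3 * toℕ i + toℕ j) mod n))

data C₆ (n : ℕ) .{{_ : NonZero n}} (j : Fin 6) : Pred (Vertex n) 0ℓ where
  u₀ : ∀ (i : Fin n) → C₆ n j (u ((6 * toℕ i + toℕ j) mod n))
  u₁ : ∀ (i : Fin n) → C₆ n j (u ((6 * toℕ i + toℕ j + 1) mod n))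
  v₃ : ∀ (i : Fin n) → C₆ n j (v ((6 * toℕ i + toℕ j + 3) mod n))
  v₄ : ∀ (i : Fin n) → C₆ n j (v ((6 * toℕ i + toℕ j + 4) mod n))

{-# OPTIONS --safe #-}

-- Let A x and B x say that u_x and v_x lie in C, indices modulo n.  Put
-- u_(x+ky) and v_(x+ky) at the point (x , y) of ℤ².  Then a total perfect
-- code is a tiling of each of two superimposed planes by 3 × 1 trominoes: on
-- points with x + y even, u's in C are centres of horizontal trominoes, and on
-- points with x + y odd, v's in C are centres of vertical ones (the other plane
-- has the parities exchanged).  The parity leaves little freedom next to a
-- tromino: from its end cell a run of trominoes is forced along a diagonal in one
-- direction (propagate), and since the diagonal closes up modulo n, in the
-- other direction too.  This gives A x → B (x + 3) and B x → A (x + 3), so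
-- A has period 6 and determines B, and exactly one of A x, A (x + 2),
-- A (x + 4) holds for each x.  Starting from i with A i, one of A (i + 3),
-- A (i + 1), A (i + 5) holds: the first gives C₃, the others C₆.
module Submission where

open import Defs
open import Data.Fin.Base using (Fin; toℕ)
open import Data.Nat.Base using (ℕ; _*_; _≤_; _%_; NonZero)
open import Data.Product.Base using (_×_; ∃)
open import Data.Sum.Base using (_⊎_)
open import Function.Bundles using (_⇔_)
open import Level using (Level)
open import Relation.Binary.PropositionalEquality using (_≡_; _≢_)
open import Relation.Unary using (Pred; _≐_)

open import Data.Empty using (⊥-elim)
open import Data.Fin.Patterns
open import Data.Fin.Properties using (toℕ-fromℕ<; toℕ<n; toℕ-injective; all?)
open import Data.List.Base using ([]; _∷_)
open import Data.Nat.Base using (zero; suc; pred; _+_; _∸_; _/_; s≤s; z≤n)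
open import Data.Nat.Divisibility using (divides-refl; m%n≡0⇒n∣m; m∣m*n)
open import Data.Nat.DivMod
open import Data.Nat.Properties
open import Data.Nat.Tactic.RingSolver using (solve)
open import Data.Product using (_,_; proj₁; proj₂; ∃!)
import Data.Product.Base as Product
open import Data.Sum.Base using (inj₁; inj₂)
import Data.Sum.Base as Sum
open import Algebra.Properties.CommutativeSemigroup +-commutativeSemigroup
  using (x∙yz≈y∙xz; xy∙z≈xz∙y)
open import Function.Base using (_∘_; id)
open import Function.Bundles using (mk⇔; Equivalence)
open import Level using (0ℓ)
open import Relation.Binary.Construct.Closure.Symmetric using (fwd; bwd)
open import Relation.Binary.PropositionalEquality
  using (refl; sym; trans; cong; cong₂; subst; subst₂; module ≡-Reasoning)
open import Relation.Nullary
  using (¬_; contradiction; Dec; ¬?; _×-dec_; _⊎-dec_; _→-dec_; from-yes)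

private variable
  ℓ : Level
  n s s′ t t′ : ℕ

-- Exactly one of three alternatives.

ExactlyOne : Set ℓ → Set ℓ → Set ℓ → Set ℓ
ExactlyOne P Q R = (P × ¬ Q × ¬ R) ⊎ (¬ P × Q × ¬ R) ⊎ (¬ P × ¬ Q × R)

module _ {P Q R : Set ℓ} where
  ¬first₂ : ExactlyOne P Q R → Q → ¬ P
  ¬first₂ (inj₁ (_ , ¬q , _)) q = contradiction q ¬q
  ¬first₂ (inj₂ (inj₁ (¬p , _))) _ = ¬p
  ¬first₂ (inj₂ (inj₂ (¬p , _))) _ = ¬p

  ¬first₃ : ExactlyOne P Q R → R → ¬ P
  ¬first₃ (inj₁ (_ , _ , ¬r)) r = contradiction r ¬r
  ¬first₃ (inj₂ (inj₁ (¬p , _))) _ = ¬p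
  ¬first₃ (inj₂ (inj₂ (¬p , _))) _ = ¬p

  first : ExactlyOne P Q R → ¬ Q → ¬ R → P
  first (inj₁ (p , _)) _ _ = p
  first (inj₂ (inj₁ (_ , q , _))) ¬q _ = contradiction q ¬q
  first (inj₂ (inj₂ (_ , _ , r))) _ ¬r = contradiction r ¬r

  first-or-second : ExactlyOne P Q R → ¬ R → P ⊎ Q
  first-or-second (inj₁ (p , _)) _ = inj₁ p
  first-or-second (inj₂ (inj₁ (_ , q , _))) _ = inj₂ q
  first-or-second (inj₂ (inj₂ (_ , _ , r))) ¬r = contradiction r ¬r

  ExactlyOne-swap : ExactlyOne P Q R → ExactlyOne Q P R
  ExactlyOne-swap (inj₁ (p , ¬q , ¬r)) = inj₂ (inj₁ (¬q , p , ¬r))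
  ExactlyOne-swap (inj₂ (inj₁ (¬p , q , ¬r))) = inj₁ (q , ¬p , ¬r)
  ExactlyOne-swap (inj₂ (inj₂ (¬p , ¬q , r))) = inj₂ (inj₂ (¬q , ¬p , r))

-- Codes as pairs of periodic predicates on ℕ, and their symmetries.

-- s′ and t′ stand for −s and −t modulo n.  The steps 1 and k are generalised to
-- s and t for the sake of the symmetries exchange, reflectA and reflectB.
record Code (n : ℕ) .{{_ : NonZero n}} (A B : ℕ → Set ℓ) (s s′ t t′ : ℕ) : Set ℓ where
  field
    s+s′  : s + s′ ≡ n
    t+t′  : t + t′ ≡ n
    respA : ∀ {x y} → x % n ≡ y % n → A x → A y
    respB : ∀ {x y} → x % n ≡ y % n → B x → B y
    atA   : ∀ x → ExactlyOne (A (x + s)) (A (x + s′)) (B x)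
    atB   : ∀ x → ExactlyOne (B (x + t)) (B (x + t′)) (A x)

  -- The full turn `z` is kept apart from `n`: at the call sites it is `s + s′` or `t + t′`, which
  -- makes `x ≡ y + z` a plain identity of sums.
  wrapA : ∀ {x y z} → z ≡ n → A y → x ≡ y + z → A x
  wrapA {y = y} refl a refl = respA (sym ([m+n]%n≡m%n y _)) a

  unwrapA : ∀ {x y z} → z ≡ n → A x → x ≡ y + z → A y
  unwrapA {y = y} refl a refl = respA ([m+n]%n≡m%n y _) a

exchange : ∀ .{{_ : NonZero n}} {A B : ℕ → Set ℓ} → Code n A B s s′ t t′ → Code n B A t t′ s s′
exchange c = record
  { s+s′ = t+t′ ; t+t′ = s+s′ ; respA = respB ; respB = respA ; atA = atB ; atB = atA }
  where open Code c

reflectA : ∀ .{{_ : NonZero n}} {A B : ℕ → Set ℓ} → Code n A B s s′ t t′ → Code n A B s′ s t t′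
reflectA {s = s} c = record
  { Code c ; s+s′ = trans (+-comm _ s) s+s′ ; atA = λ x → ExactlyOne-swap (atA x) }
  where open Code c

reflectB : ∀ .{{_ : NonZero n}} {A B : ℕ → Set ℓ} → Code n A B s s′ t t′ → Code n A B s s′ t′ t
reflectB c = exchange (reflectA (exchange c))

-- Forced diagonal runs and the shift by `3s`.

module _ .{{_ : NonZero n}} {A B : ℕ → Set ℓ} (c : Code n A B s s′ t t′) where
  open Code c
  open Code (exchange c) using () renaming (wrapA to wrapB; unwrapA to unwrapB)

  A⇒¬B+t : ∀ {x} → A x → ¬ B (x + t)
  A⇒¬B+t a = ¬first₃ (atB _) a

  B⇒¬A+s′ : ∀ {x} → B x → ¬ A (x + s′)
  B⇒¬A+s′ b = ¬first₃ (ExactlyOne-swap (atA _)) b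

  -- Otherwise `atA` at `x + s` would be met twice, by its second and its third alternative.
  A⇒¬B+s : ∀ {x} → A x → ¬ B (x + s)
  A⇒¬B+s {x} a b = B⇒¬A+s′ b (wrapA s+s′ a (+-assoc x s s′))

  A⇒¬A+2s : ∀ {x} → A x → ¬ A (x + (s + s))
  A⇒¬A+2s {x} a a′ = ¬first₂ (atA (x + s))
    (wrapA s+s′ a (+-assoc x s s′))
    (subst A (sym (+-assoc x s s)) a′)

  -- `B` at `x + 2s + t` rules out `A` at `x + s + t`, and `A x` rules out `B` at `x + t` and at
  -- `x + s`. So `atA` at `x + t` can only be met by `x + t − s`, and `atB` at `x + s + t` only by
  -- `x + s + 2t`. The new pair is the old one moved by `t − s`, which allows iteration.
  propagate : ∀ {x} → A x → B (x + (s + s + t)) →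
              A (x + (t + s′)) × B (x + (t + s′) + (s + s + t))
  propagate {x} a b =
    subst A (+-assoc x t s′) (first (ExactlyOne-swap (atA (x + t)))
      (λ a′ → ¬a (subst A e₁ a′))
      (A⇒¬B+t a)) ,
    wrapB s+s′ (first (atB (x + (s + t)))
      (λ b′ → A⇒¬B+s a (unwrapB t+t′ b′ e₃))
      ¬a) e₂
    where
    e₃ : x + (s + t) + t′ ≡ x + s + (t + t′)
    e₃ = solve (x ∷ s ∷ t ∷ t′ ∷ [])
    e₄ : x + (s + s + t) + s′ ≡ x + (s + t) + (s + s′)
    e₄ = solve (x ∷ s ∷ s′ ∷ t ∷ [])
    ¬a : ¬ A (x + (s + t))
    ¬a a′ = B⇒¬A+s′ b (wrapA s+s′ a′ e₄)
    e₁ : x + t + s ≡ x + (s + t)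
    e₁ = solve (x ∷ s ∷ t ∷ [])
    e₂ : x + (t + s′) + (s + s + t) ≡ x + (s + t) + t + (s + s′)
    e₂ = solve (x ∷ s ∷ s′ ∷ t ∷ [])

  propagate-* : ∀ {x} m → A x → B (x + (s + s + t)) →
                A (x + m * (t + s′)) × B (x + m * (t + s′) + (s + s + t))
  propagate-* {x} zero a b =
    subst A (sym (+-identityʳ x)) a ,
    subst (λ y → B (y + (s + s + t))) (sym (+-identityʳ x)) b
  propagate-* {x} (suc m) a b with propagate a b
  ... | a′ , b′ with propagate-* m a′ b′
  ... | a″ , b″ = subst A e a″ , subst (λ y → B (y + (s + s + t))) e b″
    where
    e : x + (t + s′) + m * (t + s′) ≡ x + suc m * (t + s′)
    e = +-assoc x (t + s′) (m * (t + s′))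

  -- pred n forward steps make one backward step modulo n.
  A∧B⇒B+3s : ∀ {x} → A x → B (x + (s + s + t)) → B (x + (s + s + s))
  A∧B⇒B+3s {x} a b = respB e₂ (wrapB s+s′ (proj₂ (propagate-* (pred n) a b)) (e₁ (pred n)))
    where
    open ≡-Reasoning
    y = x + (s + s + s)
    d = t + s′
    e₁ : ∀ m → x + (s + s + s) + suc m * (t + s′) ≡ x + m * (t + s′) + (s + s + t) + (s + s′)
    e₁ m = solve (x ∷ s ∷ s′ ∷ t ∷ m ∷ [])
    e₂ : (y + suc (pred n) * d) % n ≡ y % n
    e₂ = begin
      (y + suc (pred n) * d) % n  ≡⟨ cong (λ k → (y + k * d) % n) (suc-pred n) ⟩
      (y + n * d) % n             ≡⟨ cong (λ k → (y + k) % n) (*-comm n d) ⟩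
      (y + d * n) % n             ≡⟨ [m+kn]%n≡m%n y d n ⟩
      y % n                       ∎

-- As `A` fails at `x + 2s`, `atB` there yields `B` at `x + 2s + t` or `x + 2s − t`. One step back
-- along the corresponding diagonal leads to `x + 3s` in both cases.
A⇒B+3s : ∀ .{{_ : NonZero n}} {A B : ℕ → Set ℓ} → Code n A B s s′ t t′ →
         ∀ {x} → A x → B (x + (s + s + s))
A⇒B+3s {s = s} {B = B} c {x} a with first-or-second (Code.atB c (x + (s + s))) (A⇒¬A+2s c a)
... | inj₁ b = A∧B⇒B+3s c a (subst B (+-assoc x _ _) b)
... | inj₂ b = A∧B⇒B+3s (reflectB c) a (subst B (+-assoc x _ _) b)

module _ .{{_ : NonZero n}} {A B : ℕ → Set ℓ} (c : Code n A B s s′ t t′) where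
  open Code c

  -- Two diagonal steps by `s − t` carry `A` from `x + 2t + s` to `x + 3s`.
  B∧A⇒A+3s : ∀ {x} → B x → A (x + (t + t + s)) → A (x + (s + s + s))
  B∧A⇒A+3s {x} b a with propagate (exchange c) b a
  ... | b′ , a′ with propagate (exchange c) b′ a′
  ... | _ , a″ = unwrapA t+t′ (unwrapA t+t′ a″ e₁) refl
    where
    e₁ : x + (s + t′) + (s + t′) + (t + t + s) ≡ x + (s + s + s) + (t + t′) + (t + t′)
    e₁ = solve (x ∷ s ∷ t ∷ t′ ∷ [])
  B⇒A+2t±s : ∀ {x} → B x → A (x + (t + t + s)) ⊎ A (x + (t + t + s′))
  B⇒A+2t±s {x} b with first-or-second (atA (x + (t + t))) (A⇒¬A+2s (exchange c) b)
  ... | inj₁ a = inj₁ (subst A (+-assoc x _ _) a)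
  ... | inj₂ a = inj₂ (subst A (+-assoc x _ _) a)

-- Exchanging the roles in `A⇒B+3s` would give a shift by `3t`. To obtain `3s`, the trominoes next
-- to `x + 2t` and `x − 2t` are examined: one of them must lie on the `+s` side.
B⇒A+3s : ∀ .{{_ : NonZero n}} {A B : ℕ → Set ℓ} → Code n A B s s′ t t′ →
         ∀ {x} → B x → A (x + (s + s + s))
B⇒A+3s {B = B} c {x} b with B⇒A+2t±s c b
... | inj₁ a = B∧A⇒A+3s c b a
... | inj₂ a with B⇒A+2t±s (reflectB c) b
...   | inj₁ a′ = B∧A⇒A+3s (reflectB c) b a′
-- With `A` at both `x + 2t − s` and `x − 2t − s`, one diagonal step from each puts `B` at
-- `x − s − t` and at `x − s + t`, so `atB` at `x − s` is met twice.
...   | inj₂ a′ = ⊥-elim (¬first₂ (Code.atB c _)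
        (subst B (sym (+-assoc x _ _)) (proj₁ (propagate (exchange (reflectA c)) b a)))
        (subst B (sym (+-assoc x _ _)) (proj₁ (propagate (exchange (reflectA (reflectB c))) b a′))))

-- Residue arithmetic and periodic predicates.

toℕ-mod : ∀ n .{{_ : NonZero n}} x → toℕ (x mod n) ≡ x % n
toℕ-mod n x = toℕ-fromℕ< (m%n<n x n)

module _ (d : ℕ) .{{_ : NonZero d}} where

  +-cong-% : ∀ {w x y z} → w % d ≡ x % d → y % d ≡ z % d → (w + y) % d ≡ (x + z) % d
  +-cong-% {w} {x} {y} {z} e e′ =
    trans (%-distribˡ-+ w y d) (trans (cong₂ (λ a b → (a + b) % d) e e′) (sym (%-distribˡ-+ x z d)))

  +-congˡ-% : ∀ c {x y} → x % d ≡ y % d → (c + x) % d ≡ (c + y) % d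
  +-congˡ-% c = +-cong-% {c} refl

  +-congʳ-% : ∀ c {x y} → x % d ≡ y % d → (x + c) % d ≡ (y + c) % d
  +-congʳ-% c e = +-cong-% e refl

  -- `pred d * c` serves as the negative of `c` modulo `d`.
  complete-% : ∀ c x → (pred d * c + (c + x)) % d ≡ x % d
  complete-% c x = trans (cong (_% d) e) ([m+kn]%n≡m%n x c d)
    where
    e : pred d * c + (c + x) ≡ x + c * d
    e = begin
      pred d * c + (c + x)   ≡⟨ rearrange (pred d) c x ⟩
      x + c * suc (pred d)   ≡⟨ cong (λ k → x + c * k) (suc-pred d) ⟩
      x + c * d              ∎
      where
      open ≡-Reasoning
      rearrange : ∀ p c x → p * c + (c + x) ≡ x + c * suc p
      rearrange p c x = solve (p ∷ c ∷ x ∷ [])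

  +-cancelˡ-% : ∀ c {x y} → (c + x) % d ≡ (c + y) % d → x % d ≡ y % d
  +-cancelˡ-% c {x} {y} e =
    trans (sym (complete-% c x)) (trans (+-congˡ-% (pred d * c) e) (complete-% c y))

  -- Meant for case analysis: with `d` a numeral, matching on `r` runs through the residues of `x`
  -- counted from `c`.
  offset : ∀ c x → ∃ λ (r : Fin d) → x % d ≡ (c + toℕ r) % d
  offset c x = (pred d * c + x) mod d , sym (begin
    (c + toℕ ((pred d * c + x) mod d)) % d  ≡⟨ cong (λ r → (c + r) % d) (toℕ-mod d _) ⟩
    (c + (pred d * c + x) % d) % d          ≡⟨ +-congˡ-% c (m%n%n≡m%n (pred d * c + x) d) ⟩
    (c + (pred d * c + x)) % d              ≡⟨ cong (_% d) (x∙yz≈y∙xz c (pred d * c) x) ⟩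
    (pred d * c + (c + x)) % d              ≡⟨ complete-% c x ⟩
    x % d                                   ∎)
    where open ≡-Reasoning

module _ {d} .{{_ : NonZero n}} .{{_ : NonZero d}} {A : ℕ → Set ℓ}
         (resp : ∀ {x y} → x % n ≡ y % n → A x → A y) (step : ∀ {x} → A x → A (x + d)) where

  step-* : ∀ m {x} → A x → A (x + m * d)
  step-* zero    a = subst A (sym (+-identityʳ _)) a
  step-* (suc m) a = subst A (+-assoc _ d (m * d)) (step-* m (step a))

  -- Steps only go upwards. From `x` they climb to `y + q * d` with `q = x / d`, and `q * pred n`
  -- further steps reach `y + q * d * n`, which is `y` modulo `n`.
  resp-step : ∀ {x y} → x % d ≡ y % d → A x → A y
  resp-step {x} {y} e a =
    resp (trans (cong (_% n) e₂) ([m+kn]%n≡m%n y (q * d) n))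
      (step-* (q * pred n) (subst A e₁ (step-* (y / d) a)))
    where
    q = x / d
    e₁ : x + y / d * d ≡ y + q * d
    e₁ = begin
      x + y / d * d                  ≡⟨ cong (_+ y / d * d) (m≡m%n+[m/n]*n x d) ⟩
      x % d + q * d + y / d * d      ≡⟨ cong (λ r → r + q * d + y / d * d) e ⟩
      y % d + q * d + y / d * d      ≡⟨ xy∙z≈xz∙y (y % d) (q * d) (y / d * d) ⟩
      y % d + y / d * d + q * d      ≡⟨ cong (_+ q * d) (m≡m%n+[m/n]*n y d) ⟨
      y + q * d                      ∎
      where open ≡-Reasoning
    rearrange : ∀ q p → y + q * d + q * p * d ≡ y + q * d * suc p
    rearrange q p = solve (y ∷ q ∷ d ∷ p ∷ [])
    e₂ : y + q * d + q * pred n * d ≡ y + q * d * n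
    e₂ = trans (rearrange q (pred n)) (cong (λ m → y + q * d * m) (suc-pred n))

-- Every code follows one of two patterns.

Adjacent₆ : ℕ → ℕ → Set
Adjacent₆ c x = x % 6 ≡ c % 6 ⊎ x % 6 ≡ suc c % 6

-- Cases (i) and (ii) of the theorem, phrased by residues of natural-number indices.
Pattern₃ Pattern₆ : ℕ → ℕ → (A B : ℕ → Set ℓ) → Set ℓ
Pattern₃ n k A B = n % 3 ≡ 0 × k % 3 ≢ 0 × ∃ λ (j : Fin 3) →
  (∀ x → A x ⇔ x % 3 ≡ toℕ j) × (∀ x → B x ⇔ x % 3 ≡ toℕ j)
Pattern₆ n k A B = n % 6 ≡ 0 × (k % 6 ≡ 1 ⊎ k % 6 ≡ 5) × ∃ λ (j : Fin 6) →
  (∀ x → A x ⇔ Adjacent₆ (toℕ j) x) × (∀ x → B x ⇔ Adjacent₆ (toℕ j + 3) x)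

module _ .{{_ : NonZero n}} {A B : ℕ → Set ℓ} {n-1 k k′} (c : Code n A B 1 n-1 k k′) where
  open Code c

  A⇒A+6 : ∀ {x} → A x → A (x + 6)
  A⇒A+6 {x} a = subst A (+-assoc x 3 3) (B⇒A+3s c (A⇒B+3s c a))

  B⇒B+6 : ∀ {x} → B x → B (x + 6)
  B⇒B+6 {x} b = subst B (+-assoc x 3 3) (A⇒B+3s c (B⇒A+3s c b))

  resp₆A : ∀ {x y} → x % 6 ≡ y % 6 → A x → A y
  resp₆A = resp-step respA A⇒A+6

  resp₆B : ∀ {x y} → x % 6 ≡ y % 6 → B x → B y
  resp₆B = resp-step respB B⇒B+6

  A+3⇒B : ∀ {x} → A (x + 3) → B x
  A+3⇒B {x} a = resp₆B (trans (cong (_% 6) (+-assoc x 3 3)) ([m+n]%n≡m%n x 6)) (A⇒B+3s c a)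

  A+period : ∀ {x} → A x → A (x + n)
  A+period {x} = respA (sym ([m+n]%n≡m%n x n))

  ¬A+2 : ∀ {x} → A x → ¬ A (x + 2)
  ¬A+2 = A⇒¬A+2s c

  ¬A+4 : ∀ {x} → A x → ¬ A (x + 4)
  ¬A+4 {x} a a′ = ¬A+2 a′ (subst A (sym (+-assoc x 4 2)) (A⇒A+6 a))

  -- Modulo 6 and counted from `i`, the residues 1, 2, 4 and 5 each lie at distance two from 0 or
  -- from 3, so `A` holds exactly at 0 and 3. Since `A (i + n)` holds, 3 divides `n`; if 3 divided
  -- `k`, then `B (i + k)` would hold, against `A i`.
  pattern₃ : ∀ {i} → A i → A (i + 3) → Pattern₃ n k A B
  pattern₃ {i} a a₃ = n%3 , k%3 , i mod 3 ,
    (λ x → subst (λ r → A x ⇔ x % 3 ≡ r) i%3 (mk⇔ onA ofA)) ,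
    (λ x → subst (λ r → B x ⇔ x % 3 ≡ r) i%3 (mk⇔ onB ofB))
    where
    i+0 : i % 3 ≡ (i + 0) % 3
    i+0 = cong (_% 3) (sym (+-identityʳ i))
    i%3 : i % 3 ≡ toℕ (i mod 3)
    i%3 = sym (toℕ-mod 3 i)
    mod3 : ∀ x y → x % 6 ≡ y % 6 → x % 3 ≡ y % 3
    mod3 x y e = trans (sym (m∣n⇒o%n%m≡o%m 3 6 x (divides-refl 2)))
      (trans (cong (_% 3) e) (m∣n⇒o%n%m≡o%m 3 6 y (divides-refl 2)))
    onA : ∀ {x} → A x → x % 3 ≡ i % 3
    onA {x} ax with offset 6 i x
    ... | 0F , e = trans (mod3 x (i + 0) e) (sym i+0)
    ... | 1F , e = contradiction (subst A (sym (+-assoc i 1 2)) a₃) (¬A+2 (resp₆A e ax))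
    ... | 2F , e = contradiction (resp₆A e ax) (¬A+2 a)
    ... | 3F , e = trans (mod3 x (i + 3) e) ([m+n]%n≡m%n i 3)
    ... | 4F , e = contradiction (resp₆A e ax) (¬A+4 a)
    ... | 5F , e = contradiction (subst A (sym (+-assoc i 3 2)) (resp₆A e ax)) (¬A+2 a₃)
    ofA : ∀ {x} → x % 3 ≡ i % 3 → A x
    ofA {x} e₃ with offset 6 i x
    ... | r , e with +-cancelˡ-% 3 i {toℕ r} {0} (trans (sym (mod3 x (i + toℕ r) e)) (trans e₃ i+0))
    ofA e₃ | 0F , e | _ = resp₆A (sym e) (subst A (sym (+-identityʳ i)) a)
    ofA e₃ | 1F , e | ()
    ofA e₃ | 2F , e | ()
    ofA e₃ | 3F , e | _ = resp₆A (sym e) a₃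
    ofA e₃ | 4F , e | ()
    ofA e₃ | 5F , e | ()
    ofB : ∀ {x} → x % 3 ≡ i % 3 → B x
    ofB {x} e = A+3⇒B (ofA (trans ([m+n]%n≡m%n x 3) e))
    onB : ∀ {x} → B x → x % 3 ≡ i % 3
    onB {x} bx = trans (sym ([m+n]%n≡m%n x 3)) (onA (B⇒A+3s c bx))
    n%3 : n % 3 ≡ 0
    n%3 = +-cancelˡ-% 3 i {n} {0} (trans (onA (A+period a)) i+0)
    k%3 : k % 3 ≢ 0
    k%3 e = A⇒¬B+t c a (ofB (trans (+-congˡ-% 3 i {k} {0} e) (sym i+0)))

  -- The residues 2 and 4 counted from `i` are excluded by `A i`, and 3 and 5 by `A (suc i)`. The
  -- shift by 3 then determines `B`.
  pattern₆ : ∀ (j : Fin 6) → A (toℕ j) → A (suc (toℕ j)) → Pattern₆ n k A B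
  pattern₆ j a a₁ = n%6 , k%6 , j , (λ x → mk⇔ onA ofA) , λ x → mk⇔ onB ofB
    where
    i = toℕ j
    b : B (i + 3)
    b = A⇒B+3s c a
    b₁ : B (suc i + 3)
    b₁ = A⇒B+3s c a₁
    onA : ∀ {x} → A x → Adjacent₆ i x
    onA {x} ax with offset 6 i x
    ... | 0F , e = inj₁ (trans e (cong (_% 6) (+-identityʳ i)))
    ... | 1F , e = inj₂ (trans e (cong (_% 6) (+-comm i 1)))
    ... | 2F , e = contradiction (resp₆A e ax) (¬A+2 a)
    ... | 3F , e = contradiction (subst A (+-suc i 2) (resp₆A e ax)) (¬A+2 a₁)
    ... | 4F , e = contradiction (resp₆A e ax) (¬A+4 a)
    ... | 5F , e = contradiction (subst A (+-suc i 4) (resp₆A e ax)) (¬A+4 a₁)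
    ofA : ∀ {x} → Adjacent₆ i x → A x
    ofA (inj₁ e) = resp₆A (sym e) a
    ofA (inj₂ e) = resp₆A (sym e) a₁
    onB : ∀ {x} → B x → Adjacent₆ (i + 3) x
    onB {x} bx = Sum.map (shift i) (shift (suc i)) (onA (B⇒A+3s c bx))
      where
      shift : ∀ c → (x + 3) % 6 ≡ c % 6 → x % 6 ≡ (c + 3) % 6
      shift c e = trans (sym ([m+n]%n≡m%n x 6))
        (trans (cong (_% 6) (sym (+-assoc x 3 3))) (+-congʳ-% 6 3 {x + 3} {c} e))
    ofB : ∀ {x} → Adjacent₆ (i + 3) x → B x
    ofB (inj₁ e) = resp₆B (sym e) b
    ofB (inj₂ e) = resp₆B (sym e) b₁
    +0 : ∀ x → x % 6 ≡ (x + 0) % 6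
    +0 x = cong (_% 6) (sym (+-identityʳ x))
    n%6 : n % 6 ≡ 0
    -- Translation by `n` keeps the pair `i`, `i + 1` modulo 6. Swapping its two members would need
    -- both `n ≡ 1` and `n + 1 ≡ 0`.
    n%6 with onA (A+period a) | onA (A+period a₁)
    ... | inj₁ e | _ = +-cancelˡ-% 6 i {n} {0} (trans e (+0 i))
    ... | inj₂ _ | inj₂ e = +-cancelˡ-% 6 (suc i) {n} {0} (trans e (+0 (suc i)))
    ... | inj₂ e | inj₁ e₁ = contradiction (trans (sym (+-congˡ-% 6 1 {n} {1} n≡1)) n+1≡0) λ ()
      where
      n≡1 : n % 6 ≡ 1
      n≡1 = +-cancelˡ-% 6 i {n} {1} (trans e (cong (_% 6) (+-comm 1 i)))
      n+1≡0 : suc n % 6 ≡ 0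
      n+1≡0 = +-cancelˡ-% 6 i {suc n} {0} (trans (cong (_% 6) (+-suc i n)) (trans e₁ (+0 i)))
    move : ∀ c d → k % 6 ≡ d % 6 → B (c + d) → B (c + k)
    move c d e = resp₆B (sym (+-congˡ-% 6 c {k} {d} e))
    k%6 : (k % 6 ≡ 1 ⊎ k % 6 ≡ 5)
    k%6 with offset 6 0 k
    -- Here `B` would hold at `i + 3` and also two inner steps further on, at `i + 3 + 2k`.
    ... | 0F , e = contradiction (resp₆B (sym k+k) b) (A⇒¬A+2s (exchange c) b)
      where
      k+k : (i + 3 + (k + k)) % 6 ≡ (i + 3) % 6
      k+k = trans (+-congˡ-% 6 (i + 3) {k + k} {0} (+-cong-% 6 {k} {0} {k} {0} e e)) (sym (+0 (i + 3)))
    ... | 1F , e = inj₁ e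
    -- For residues 2, 3 and 4, one inner step from `i` or `i + 1`, where `A` holds, ends at `i + 3`
    -- or `i + 4` modulo 6, where `B` holds.
    ... | 2F , e = contradiction (move (suc i) 2 e (subst B (+-suc i 2) b)) (A⇒¬B+t c a₁)
    ... | 3F , e = contradiction (move i 3 e b) (A⇒¬B+t c a)
    ... | 4F , e = contradiction (move i 4 e (subst B (sym (+-suc i 3)) b₁)) (A⇒¬B+t c a)
    ... | 5F , e = inj₂ e

  pattern₆′ : ∀ {i} → A i → A (suc i) → Pattern₆ n k A B
  pattern₆′ {i} a a₁ = pattern₆ (i mod 6) (resp₆A e a) (resp₆A (+-congˡ-% 6 1 {i} {toℕ (i mod 6)} e) a₁)
    where
    e : i % 6 ≡ toℕ (i mod 6) % 6
    e = sym (trans (cong (_% 6) (toℕ-mod 6 i)) (m%n%n≡m%n i 6))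

  start : ∃ A
  start with atA 0
  ... | inj₁ (a , _) = 1 , a
  ... | inj₂ (inj₁ (_ , a , _)) = n-1 , a
  ... | inj₂ (inj₂ (_ , _ , b)) = 3 , B⇒A+3s c b

  classify : Pattern₃ n k A B ⊎ Pattern₆ n k A B
  classify with start
  ... | i , a with atA (i + 2)
  ... | inj₁ (a₃ , _) = inj₁ (pattern₃ a (subst A (+-assoc i 2 1) a₃))
  ... | inj₂ (inj₁ (_ , a₁ , _)) = inj₂ (pattern₆′ a (unwrapA s+s′ a₁ e))
    where
    e : i + 2 + n-1 ≡ suc i + (1 + n-1)
    e = solve (i ∷ n-1 ∷ [])
  -- `B (i + 2)` gives `A (i + 5)`, and `A i` gives `A (i + 6)`, so the adjacent pair begins at
  -- `i + 5`.
  ... | inj₂ (inj₂ (_ , _ , b)) = inj₂ (pattern₆′ (B⇒A+3s c b) (subst A e (A⇒A+6 a)))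
    where
    e : i + 6 ≡ suc (i + 2 + 3)
    e = solve (i ∷ [])

-- Both patterns satisfy the code conditions: finite checks on residues.

exactlyOne? : ∀ {P Q R : Set ℓ} → Dec P → Dec Q → Dec R → Dec (ExactlyOne P Q R)
exactlyOne? p q r =
  (p ×-dec ¬? q ×-dec ¬? r) ⊎-dec (¬? p ×-dec q ×-dec ¬? r) ⊎-dec (¬? p ×-dec ¬? q ×-dec r)

ExactlyOne-map : ∀ {ℓ′} {P Q R : Set ℓ} {P′ Q′ R′ : Set ℓ′} → P ⇔ P′ → Q ⇔ Q′ → R ⇔ R′ →
                 ExactlyOne P Q R → ExactlyOne P′ Q′ R′
ExactlyOne-map p q r =
  Sum.map (Product.map (to p) (Product.map (_∘ from q) (_∘ from r)))
  (Sum.map (Product.map (_∘ from p) (Product.map (to q) (_∘ from r)))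
           (Product.map (_∘ from p) (Product.map (_∘ from q) (to r))))
  where open Equivalence

-- With `b ≡ −a` and `a ≢ 0`, the numbers `r`, `r + a`, `r + b` run through all residues modulo 3.
-- The proof evaluates the 81 cases.
residues₃ : ∀ (j r a b : Fin 3) → (toℕ a + toℕ b) % 3 ≡ 0 → toℕ a % 3 ≢ 0 →
            ExactlyOne ((toℕ r + toℕ a) % 3 ≡ toℕ j) ((toℕ r + toℕ b) % 3 ≡ toℕ j) (toℕ r % 3 ≡ toℕ j)
residues₃ = from-yes (all? {n = 3} λ j → all? {n = 3} λ r → all? {n = 3} λ a → all? {n = 3} λ b →
  ((toℕ a + toℕ b) % 3 ≟ 0) →-dec (¬? (toℕ a % 3 ≟ 0) →-dec
  exactlyOne? ((toℕ r + toℕ a) % 3 ≟ toℕ j) ((toℕ r + toℕ b) % 3 ≟ toℕ j) (toℕ r % 3 ≟ toℕ j)))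

exactlyOne₃ : ∀ (j : Fin 3) x a b → (a + b) % 3 ≡ 0 → a % 3 ≢ 0 →
              ExactlyOne ((x + a) % 3 ≡ toℕ j) ((x + b) % 3 ≡ toℕ j) (x % 3 ≡ toℕ j)
exactlyOne₃ j x a b e a≢0 with offset 3 0 x | offset 3 0 a | offset 3 0 b
... | r , x≡r | s , a≡s | t , b≡t =
  ExactlyOne-map (≡-resp (+-cong-% 3 {x} {toℕ r} {a} {toℕ s} x≡r a≡s))
    (≡-resp (+-cong-% 3 {x} {toℕ r} {b} {toℕ t} x≡r b≡t)) (≡-resp x≡r)
    (residues₃ j r s t (trans (sym (+-cong-% 3 {a} {toℕ s} {b} {toℕ t} a≡s b≡t)) e) (a≢0 ∘ trans a≡s))
  where
  ≡-resp : ∀ {x y z : ℕ} → x ≡ y → y ≡ z ⇔ x ≡ z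
  ≡-resp refl = mk⇔ id id

adjacent₆? : ∀ c x → Dec (Adjacent₆ c x)
adjacent₆? c x = (x % 6 ≟ c % 6) ⊎-dec (x % 6 ≟ suc c % 6)

-- Here `a` and `b` are opposite steps. The first conjunct is for the neighbourhood of an outer
-- vertex, with steps `1` and `n ∸ 1`, the second for that of an inner vertex, with steps `k` and
-- `n ∸ k`.
Alternate₆ : ℕ → ℕ → ℕ → ℕ → Set
Alternate₆ c x a b =
  ExactlyOne (Adjacent₆ c (x + a)) (Adjacent₆ c (x + b)) (Adjacent₆ (c + 3) x) ×
  ExactlyOne (Adjacent₆ (c + 3) (x + a)) (Adjacent₆ (c + 3) (x + b)) (Adjacent₆ c x)

alternate₆? : ∀ c x a b → Dec (Alternate₆ c x a b)
alternate₆? c x a b =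
  exactlyOne? (adjacent₆? c (x + a)) (adjacent₆? c (x + b)) (adjacent₆? (c + 3) x) ×-dec
  exactlyOne? (adjacent₆? (c + 3) (x + a)) (adjacent₆? (c + 3) (x + b)) (adjacent₆? c x)

-- Shifting a pair of consecutive residues by -1, 1 and 3 partitions the residues modulo 6.
residues₆ : ∀ (j r : Fin 6) → Alternate₆ (toℕ j) (toℕ r) 1 5 × Alternate₆ (toℕ j) (toℕ r) 5 1
residues₆ = from-yes (all? {n = 6} λ j → all? {n = 6} λ r →
  alternate₆? (toℕ j) (toℕ r) 1 5 ×-dec alternate₆? (toℕ j) (toℕ r) 5 1)

Adjacent₆-resp : ∀ c x y → x % 6 ≡ y % 6 → Adjacent₆ c x ⇔ Adjacent₆ c y
Adjacent₆-resp c x y e = mk⇔ (Sum.map (trans (sym e)) (trans (sym e))) (Sum.map (trans e) (trans e))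

Alternate₆-resp : ∀ c x a b y a′ b′ → x % 6 ≡ y % 6 → a % 6 ≡ a′ % 6 → b % 6 ≡ b′ % 6 →
                  Alternate₆ c x a b → Alternate₆ c y a′ b′
Alternate₆-resp c x a b y a′ b′ e ea eb = Product.map
  (ExactlyOne-map (Adjacent₆-resp c (x + a) (y + a′) xa) (Adjacent₆-resp c (x + b) (y + b′) xb)
                  (Adjacent₆-resp (c + 3) x y e))
  (ExactlyOne-map (Adjacent₆-resp (c + 3) (x + a) (y + a′) xa) (Adjacent₆-resp (c + 3) (x + b) (y + b′) xb)
                  (Adjacent₆-resp c x y e))
  where
  xa = +-cong-% 6 {x} {y} {a} {a′} e ea
  xb = +-cong-% 6 {x} {y} {b} {b′} e eb

alternate₆ : ∀ (j : Fin 6) x a b → (a + b) % 6 ≡ 0 → a % 6 ≡ 1 ⊎ a % 6 ≡ 5 → Alternate₆ (toℕ j) x a b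
alternate₆ j x a b e a∈ with offset 6 0 x
alternate₆ j x a b e (inj₁ a≡1) | r , x≡r =
  Alternate₆-resp (toℕ j) (toℕ r) 1 5 x a b (sym x≡r) (sym a≡1)
    (+-cancelˡ-% 6 1 {5} {b} (trans (sym e) (+-congʳ-% 6 b {a} {1} a≡1))) (proj₁ (residues₆ j r))
alternate₆ j x a b e (inj₂ a≡5) | r , x≡r =
  Alternate₆-resp (toℕ j) (toℕ r) 5 1 x a b (sym x≡r) (sym a≡5)
    (+-cancelˡ-% 6 5 {1} {b} (trans (sym e) (+-congʳ-% 6 b {a} {5} a≡5))) (proj₂ (residues₆ j r))

-- Indices in `Fin n`, unique neighbours and arithmetic progressions.

mod-cong : ∀ .{{_ : NonZero n}} {x y} → x % n ≡ y % n → x mod n ≡ y mod n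
mod-cong {n = n} {x} {y} e = toℕ-injective (trans (toℕ-mod n x) (trans e (sym (toℕ-mod n y))))

mod-toℕ : ∀ .{{_ : NonZero n}} (f : Fin n) → toℕ f mod n ≡ f
mod-toℕ {n = n} f = toℕ-injective (trans (toℕ-mod n (toℕ f)) (m<n⇒m%n≡m (toℕ<n f)))

mod-⊕ : ∀ .{{_ : NonZero n}} x m → (x mod n) ⊕ m ≡ (x + m) mod n
mod-⊕ {n = n} x m = mod-cong (+-congʳ-% n m (trans (cong (_% n) (toℕ-mod n x)) (m%n%n≡m%n x n)))

⊕-⊕ : ∀ .{{_ : NonZero n}} (f : Fin n) {m m′} → m + m′ ≡ n → (f ⊕ m) ⊕ m′ ≡ f
⊕-⊕ {n = n} f {m} {m′} e = begin
  (f ⊕ m) ⊕ m′             ≡⟨ mod-⊕ (toℕ f + m) m′ ⟩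
  (toℕ f + m + m′) mod n   ≡⟨ cong (_mod n) (trans (+-assoc (toℕ f) m m′) (cong (toℕ f +_) e)) ⟩
  (toℕ f + n) mod n        ≡⟨ mod-cong ([m+n]%n≡m%n (toℕ f) n) ⟩
  toℕ f mod n              ≡⟨ mod-toℕ f ⟩
  f                        ∎
  where open ≡-Reasoning

-- As `m′` is `−m` modulo `n`, equality would force `2m ≡ 0`.
⊕-distinct : ∀ .{{_ : NonZero n}} (f : Fin n) {m m′} → m + m′ ≡ n → (2 * m) % n ≢ 0 → f ⊕ m ≢ f ⊕ m′
⊕-distinct {n = n} f {m} {m′} e 2m≢0 eq = 2m≢0 (begin
  (2 * m) % n    ≡⟨ cong (λ k → (m + k) % n) (+-identityʳ m) ⟩
  (m + m) % n    ≡⟨ +-congˡ-% n m (+-cancelˡ-% n (toℕ f) same) ⟩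
  (m + m′) % n   ≡⟨ cong (_% n) e ⟩
  n % n          ≡⟨ n%n≡0 n ⟩
  0              ∎)
  where
  open ≡-Reasoning
  same : (toℕ f + m) % n ≡ (toℕ f + m′) % n
  same = trans (sym (toℕ-mod n _)) (trans (cong toℕ eq) (toℕ-mod n _))

-- The unique neighbour comes as data, so locating it among `p`, `q`, `r` decides membership of all
-- three although `C` is an arbitrary predicate.
∃!⇔ExactlyOne : ∀ {V : Set} (C : V → Set ℓ) {N : V → Set} {p q r} → N p → N q → N r →
                (∀ {y} → N y → y ≡ p ⊎ y ≡ q ⊎ y ≡ r) → p ≢ q → p ≢ r → q ≢ r →
                ∃! _≡_ (λ y → C y × N y) ⇔ ExactlyOne (C p) (C q) (C r)
∃!⇔ExactlyOne C {N} {p} {q} {r} np nq nr only p≢q p≢r q≢r = mk⇔ to from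
  where
  to : ∃! _≡_ (λ y → C y × N y) → ExactlyOne (C p) (C q) (C r)
  to (y , (cy , ny) , uniq) with only ny
  ... | inj₁ refl = inj₁ (cy , (λ cq → p≢q (uniq (cq , nq))) , (λ cr → p≢r (uniq (cr , nr))))
  ... | inj₂ (inj₁ refl) = inj₂ (inj₁ ((λ cp → p≢q (sym (uniq (cp , np)))) , cy , (λ cr → q≢r (uniq (cr , nr)))))
  ... | inj₂ (inj₂ refl) = inj₂ (inj₂ ((λ cp → p≢r (sym (uniq (cp , np)))) , (λ cq → q≢r (sym (uniq (cq , nq)))) , cy))

  among : ∀ {z} → (C p → z ≡ p) → (C q → z ≡ q) → (C r → z ≡ r) → ∀ {y} → C y × N y → z ≡ y
  among zp zq zr (cy , ny) with only ny
  ... | inj₁ refl = zp cy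
  ... | inj₂ (inj₁ refl) = zq cy
  ... | inj₂ (inj₂ refl) = zr cy

  from : ExactlyOne (C p) (C q) (C r) → ∃! _≡_ (λ y → C y × N y)
  from (inj₁ (cp , ¬q , ¬r)) =
    p , (cp , np) , among (λ _ → refl) (λ cq → contradiction cq ¬q) (λ cr → contradiction cr ¬r)
  from (inj₂ (inj₁ (¬p , cq , ¬r))) =
    q , (cq , nq) , among (λ cp → contradiction cp ¬p) (λ _ → refl) (λ cr → contradiction cr ¬r)
  from (inj₂ (inj₂ (¬p , ¬q , cr))) =
    r , (cr , nr) , among (λ cp → contradiction cp ¬p) (λ cq → contradiction cq ¬q) (λ _ → refl)

progression : ∀ d n .{{_ : NonZero d}} .{{_ : NonZero n}} c (f : Fin n) → toℕ f % d ≡ c % d →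
              ∃ λ (i : Fin n) → (d * toℕ i + c) mod n ≡ f
progression d n c f e = x mod n , (begin
  (d * toℕ (x mod n) + c) mod n    ≡⟨ mod-cong (trans (+-congʳ-% n c {d * toℕ (x mod n)} {d * x} e₀) e₁) ⟩
  toℕ f mod n                      ≡⟨ mod-toℕ f ⟩
  f                                ∎)
  where
  open ≡-Reasoning
  m = toℕ f
  -- `pred n` acts as -1 modulo `n`, so `x` is the difference of the quotients of `m` and `c`. The
  -- quotient of `c` can be positive, for instance for `toℕ j + 4` with `d = 6`.
  x = m / d + c / d * pred n
  e₀ : (d * toℕ (x mod n)) % n ≡ (d * x) % n
  e₀ = trans (%-distribˡ-* d (toℕ (x mod n)) n)
       (trans (cong (λ y → (d % n * y) % n) (trans (cong (_% n) (toℕ-mod n x)) (m%n%n≡m%n x n)))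
              (sym (%-distribˡ-* d x n)))
  rearrange : ∀ p q r n → d * (p + q * n) + (r + q * d) ≡ r + p * d + d * q * suc n
  rearrange p q r n = solve (d ∷ p ∷ q ∷ r ∷ n ∷ [])
  e₁ : (d * x + c) % n ≡ m % n
  e₁ = begin
    (d * x + c) % n                                  ≡⟨ cong (λ y → (d * x + y) % n) (m≡m%n+[m/n]*n c d) ⟩
    (d * x + (c % d + c / d * d)) % n                ≡⟨ cong (_% n) (rearrange (m / d) (c / d) (c % d) (pred n)) ⟩
    (c % d + m / d * d + d * (c / d) * suc (pred n)) % n
      ≡⟨ cong₂ (λ r s → (r + m / d * d + d * (c / d) * s) % n) (sym e) (suc-pred n) ⟩
    (m % d + m / d * d + d * (c / d) * n) % n        ≡⟨ [m+kn]%n≡m%n _ (d * (c / d)) n ⟩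
    (m % d + m / d * d) % n                          ≡⟨ cong (_% n) (m≡m%n+[m/n]*n m d) ⟨
    m % n                                            ∎

-- Wrapping round modulo `n` preserves residues modulo `d` because `d` divides `n`.
toℕ-mod-% : ∀ {d n} .{{_ : NonZero d}} .{{_ : NonZero n}} → n % d ≡ 0 →
            ∀ x → toℕ (x mod n) % d ≡ x % d
toℕ-mod-% {d} {n} e x = trans (cong (_% d) (toℕ-mod n x)) (m∣n⇒o%n%m≡o%m d n x (m%n≡0⇒n∣m n d e))

progression-% : ∀ {d n} .{{_ : NonZero d}} .{{_ : NonZero n}} → n % d ≡ 0 → ∀ c (i : Fin n) →
                toℕ ((d * toℕ i + c) mod n) % d ≡ c % d
progression-% {d} e c i = trans (toℕ-mod-% e (d * toℕ i + c)) (%-remove-+ˡ c (m∣m*n (toℕ i)))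

-- Total perfect codes in terms of the three neighbours of each vertex.

module Neighbourhoods {ℓ} (n : ℕ) .{{_ : NonZero n}} (3≤n : 3 ≤ n) (k : Fin n) (k≢0 : toℕ k ≢ 0)
                      (2k≢0 : (2 * toℕ k) % n ≢ 0) (C : Pred (Vertex n) ℓ) where
  open SimpleGraph (GP n 3≤n k k≢0)

  1+n-1 : 1 + (n ∸ 1) ≡ n
  1+n-1 = m+[n∸m]≡n (≤-trans (s≤s z≤n) 3≤n)

  k+n-k : toℕ k + (n ∸ toℕ k) ≡ n
  k+n-k = m+[n∸m]≡n (<⇒≤ (toℕ<n k))

  ⊕-inverse : ∀ {m m′} → m + m′ ≡ n → ∀ f → (f ⊕ m′) ⊕ m ≡ f
  ⊕-inverse {m} {m′} e f = ⊕-⊕ f (trans (+-comm m′ m) e)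

  AtU AtV : Fin n → Set ℓ
  AtU f = ExactlyOne (C (u (f ⊕ 1))) (C (u (f ⊕ (n ∸ 1)))) (C (v f))
  AtV f = ExactlyOne (C (v (f ⊕ toℕ k))) (C (v (f ⊕ (n ∸ toℕ k)))) (C (u f))

  unique-at-u : ∀ f → ∃! _≡_ (λ y → C y × u f ~ y) ⇔ AtU f
  unique-at-u f = ∃!⇔ExactlyOne C (fwd (outer f))
    (bwd (subst (λ g → Edge n k (u (f ⊕ (n ∸ 1))) (u g)) (⊕-inverse 1+n-1 f) (outer _)))
    (fwd (spoke f)) only
    -- The two outer neighbours differ because `2 < n`, so 2 is its own nonzero residue.
    (⊕-distinct f 1+n-1 (λ e → contradiction (trans (sym (m<n⇒m%n≡m 3≤n)) e) λ ()) ∘ u-injective)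
    (λ ()) (λ ())
    where
    only : ∀ {y} → u f ~ y → y ≡ u (f ⊕ 1) ⊎ y ≡ u (f ⊕ (n ∸ 1)) ⊎ y ≡ v f
    only (fwd (outer _)) = inj₁ refl
    only (fwd (spoke _)) = inj₂ (inj₂ refl)
    only (bwd (outer g)) = inj₂ (inj₁ (cong u (sym (⊕-⊕ g 1+n-1))))

  unique-at-v : ∀ f → ∃! _≡_ (λ y → C y × v f ~ y) ⇔ AtV f
  unique-at-v f = ∃!⇔ExactlyOne C (fwd (inner f))
    (bwd (subst (λ g → Edge n k (v (f ⊕ (n ∸ toℕ k))) (v g)) (⊕-inverse k+n-k f) (inner _)))
    (bwd (spoke f)) only
    (⊕-distinct f k+n-k 2k≢0 ∘ v-injective)
    (λ ()) (λ ())
    where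
    only : ∀ {y} → v f ~ y → y ≡ v (f ⊕ toℕ k) ⊎ y ≡ v (f ⊕ (n ∸ toℕ k)) ⊎ y ≡ u f
    only (fwd (inner _)) = inj₁ refl
    only (bwd (spoke _)) = inj₂ (inj₂ refl)
    only (bwd (inner g)) = inj₂ (inj₁ (cong v (sym (⊕-⊕ g k+n-k))))

  -- Pulling `C` back along `_mod n` gives periodic predicates on ℕ, where indices are added without
  -- reduction.
  fromTPC : TotalPerfectCode (GP n 3≤n k k≢0) C →
            Code n (λ x → C (u (x mod n))) (λ x → C (v (x mod n))) 1 (n ∸ 1) (toℕ k) (n ∸ toℕ k)
  fromTPC tpc = record
    { s+s′  = 1+n-1
    ; t+t′  = k+n-k
    ; respA = λ e → subst (C ∘ u) (mod-cong e)
    ; respB = λ e → subst (C ∘ v) (mod-cong e)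
    ; atA   = λ x → subst₂ (λ f g → ExactlyOne (C (u f)) (C (u g)) (C (v (x mod n))))
        (mod-⊕ x 1) (mod-⊕ x (n ∸ 1)) (to (unique-at-u (x mod n)) (tpc (u (x mod n))))
    ; atB   = λ x → subst₂ (λ f g → ExactlyOne (C (v f)) (C (v g)) (C (u (x mod n))))
        (mod-⊕ x (toℕ k)) (mod-⊕ x (n ∸ toℕ k)) (to (unique-at-v (x mod n)) (tpc (v (x mod n))))
    }
    where open Equivalence

  toTPC : (∀ f → AtU f) → (∀ f → AtV f) → TotalPerfectCode (GP n 3≤n k k≢0) C
  toTPC atU atV (u f) = Equivalence.from (unique-at-u f) (atU f)
  toTPC atU atV (v f) = Equivalence.from (unique-at-v f) (atV f)

-- Membership in `C₃` and `C₆` read off from residues.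

module _ {n} .{{_ : NonZero n}} (n%3 : n % 3 ≡ 0) (j : Fin 3) where

  u∈C₃ : ∀ f → C₃ n j (u f) ⇔ toℕ f % 3 ≡ toℕ j
  u∈C₃ f = mk⇔ residue member
    where
    residue : ∀ {f} → C₃ n j (u f) → toℕ f % 3 ≡ toℕ j
    residue (u₀ i) = trans (progression-% n%3 (toℕ j) i) (m<n⇒m%n≡m (toℕ<n j))
    member : toℕ f % 3 ≡ toℕ j → C₃ n j (u f)
    member e with progression 3 n (toℕ j) f (trans e (sym (m<n⇒m%n≡m (toℕ<n j))))
    ... | i , refl = u₀ i

  v∈C₃ : ∀ f → C₃ n j (v f) ⇔ toℕ f % 3 ≡ toℕ j
  v∈C₃ f = mk⇔ residue member
    where
    residue : ∀ {f} → C₃ n j (v f) → toℕ f % 3 ≡ toℕ j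
    residue (v₀ i) = trans (progression-% n%3 (toℕ j) i) (m<n⇒m%n≡m (toℕ<n j))
    member : toℕ f % 3 ≡ toℕ j → C₃ n j (v f)
    member e with progression 3 n (toℕ j) f (trans e (sym (m<n⇒m%n≡m (toℕ<n j))))
    ... | i , refl = v₀ i

module _ {n} .{{_ : NonZero n}} (n%6 : n % 6 ≡ 0) (j : Fin 6) where

  residue₆ : ∀ (i : Fin n) c → toℕ ((6 * toℕ i + toℕ j + c) mod n) % 6 ≡ (toℕ j + c) % 6
  residue₆ i c = trans (cong (λ x → toℕ (x mod n) % 6) (+-assoc (6 * toℕ i) (toℕ j) c))
                       (progression-% n%6 (toℕ j + c) i)

  progression₆ : ∀ c f → toℕ f % 6 ≡ (toℕ j + c) % 6 →
                 ∃ λ (i : Fin n) → (6 * toℕ i + toℕ j + c) mod n ≡ f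
  progression₆ c f e with progression 6 n (toℕ j + c) f e
  ... | i , eq = i , trans (cong (_mod n) (+-assoc (6 * toℕ i) (toℕ j) c)) eq

  u∈C₆ : ∀ f → C₆ n j (u f) ⇔ Adjacent₆ (toℕ j) (toℕ f)
  u∈C₆ f = mk⇔ residue member
    where
    residue : ∀ {f} → C₆ n j (u f) → Adjacent₆ (toℕ j) (toℕ f)
    residue (u₀ i) = inj₁ (progression-% n%6 (toℕ j) i)
    residue (u₁ i) = inj₂ (trans (residue₆ i 1) (cong (_% 6) (+-comm (toℕ j) 1)))
    member : Adjacent₆ (toℕ j) (toℕ f) → C₆ n j (u f)
    member (inj₁ e) with progression 6 n (toℕ j) f e
    ... | i , refl = u₀ i
    member (inj₂ e) with progression₆ 1 f (trans e (cong (_% 6) (+-comm 1 (toℕ j))))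
    ... | i , refl = u₁ i

  v∈C₆ : ∀ f → C₆ n j (v f) ⇔ Adjacent₆ (toℕ j + 3) (toℕ f)
  v∈C₆ f = mk⇔ residue member
    where
    residue : ∀ {f} → C₆ n j (v f) → Adjacent₆ (toℕ j + 3) (toℕ f)
    residue (v₃ i) = inj₁ (residue₆ i 3)
    residue (v₄ i) = inj₂ (trans (residue₆ i 4) (cong (_% 6) (+-suc (toℕ j) 3)))
    member : Adjacent₆ (toℕ j + 3) (toℕ f) → C₆ n j (v f)
    member (inj₁ e) with progression₆ 3 f e
    ... | i , refl = v₃ i
    member (inj₂ e) with progression₆ 4 f (trans e (cong (_% 6) (sym (+-suc (toℕ j) 3))))
    ... | i , refl = v₄ i

module _ {n} .{{_ : NonZero n}} {C : Pred (Vertex n) ℓ} {D : Pred (Vertex n) 0ℓ}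
         (P Q : ℕ → Set) (u∈D : ∀ f → D (u f) ⇔ P (toℕ f)) (v∈D : ∀ f → D (v f) ⇔ Q (toℕ f)) where
  open Equivalence

  agree : (∀ x → C (u (x mod n)) ⇔ P x) → (∀ x → C (v (x mod n)) ⇔ Q x) → C ≐ D
  agree u∈C v∈C = C⊆D , D⊆C
    where
    C⊆D : ∀ {x} → C x → D x
    C⊆D {u f} c = from (u∈D f) (to (u∈C (toℕ f)) (subst (C ∘ u) (sym (mod-toℕ f)) c))
    C⊆D {v f} c = from (v∈D f) (to (v∈C (toℕ f)) (subst (C ∘ v) (sym (mod-toℕ f)) c))
    D⊆C : ∀ {x} → D x → C x
    D⊆C {u f} d = subst (C ∘ u) (mod-toℕ f) (from (u∈C (toℕ f)) (to (u∈D f) d))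
    D⊆C {v f} d = subst (C ∘ v) (mod-toℕ f) (from (v∈C (toℕ f)) (to (v∈D f) d))

  members : C ≐ D → (∀ f → P (toℕ f) ⇔ C (u f)) × (∀ f → Q (toℕ f) ⇔ C (v f))
  members (C⊆D , D⊆C) = (λ f → mk⇔ (D⊆C ∘ from (u∈D f)) (to (u∈D f) ∘ C⊆D))
                      , (λ f → mk⇔ (D⊆C ∘ from (v∈D f)) (to (v∈D f) ∘ C⊆D))

-- The characterisation of the total perfect codes.

theorem1p2 : ∀ {ℓ : Level} (n : ℕ) .{{_ : NonZero n}} (3≤n : 3 ≤ n)
    (k : Fin n) (k≢0 : toℕ k ≢ 0) → (2 * toℕ k) % n ≢ 0 →
    (C : Pred (Vertex n) ℓ) →
    TotalPerfectCode (GP n 3≤n k k≢0) C ⇔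
    ( (n % 3 ≡ 0 × toℕ k % 3 ≢ 0 × ∃ λ (j : Fin 3) → C ≐ C₃ n j)
    ⊎ (n % 6 ≡ 0 × (toℕ k % 6 ≡ 1 ⊎ toℕ k % 6 ≡ 5) × ∃ λ (j : Fin 6) → C ≐ C₆ n j) )
theorem1p2 {ℓ} n 3≤n k k≢0 2k≢0 C = mk⇔
  (λ tpc → Sum.map
    (λ { (n%3 , k%3 , j , u∈C , v∈C) →
         n%3 , k%3 , j , agree (P₃ j) (P₃ j) (u∈C₃ n%3 j) (v∈C₃ n%3 j) u∈C v∈C })
    (λ { (n%6 , k%6 , j , u∈C , v∈C) →
         n%6 , k%6 , j , agree (P₆ j) (Q₆ j) (u∈C₆ n%6 j) (v∈C₆ n%6 j) u∈C v∈C })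
    (classify (fromTPC tpc)))
  λ { (inj₁ (n%3 , k%3 , j , C≐)) → code₃ n%3 k%3 j C≐
    ; (inj₂ (n%6 , k%6 , j , C≐)) → code₆ n%6 k%6 j C≐ }
  where
  open Neighbourhoods n 3≤n k k≢0 2k≢0 C

  P₃ : Fin 3 → ℕ → Set
  P₃ j x = x % 3 ≡ toℕ j
  P₆ Q₆ : Fin 6 → ℕ → Set
  P₆ j = Adjacent₆ (toℕ j)
  Q₆ j = Adjacent₆ (toℕ j + 3)

  code₃ : n % 3 ≡ 0 → toℕ k % 3 ≢ 0 → ∀ j → C ≐ C₃ n j →
          TotalPerfectCode (GP n 3≤n k k≢0) C
  code₃ n%3 k%3 j C≐ with members (P₃ j) (P₃ j) (u∈C₃ n%3 j) (v∈C₃ n%3 j) C≐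
  ... | u∈C , v∈C = toTPC
    (λ f → ExactlyOne-map (at u∈C f 1) (at u∈C f (n ∸ 1)) (v∈C f)
      (exactlyOne₃ j (toℕ f) 1 (n ∸ 1) (trans (cong (_% 3) 1+n-1) n%3) λ ()))
    (λ f → ExactlyOne-map (at v∈C f (toℕ k)) (at v∈C f (n ∸ toℕ k)) (u∈C f)
      (exactlyOne₃ j (toℕ f) (toℕ k) (n ∸ toℕ k) (trans (cong (_% 3) k+n-k) n%3) k%3))
    where
    -- The index `f ⊕ m` is reduced modulo `n`; as 3 divides `n`, its residue modulo 3 is still that
    -- of `toℕ f + m`.
    at : {P : Fin n → Set ℓ} → (∀ f → P₃ j (toℕ f) ⇔ P f) →
         ∀ f m → P₃ j (toℕ f + m) ⇔ P (f ⊕ m)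
    at {P} P⇔ f m =
      subst (λ r → r ≡ toℕ j ⇔ P (f ⊕ m)) (toℕ-mod-% n%3 (toℕ f + m)) (P⇔ (f ⊕ m))

  code₆ : n % 6 ≡ 0 → toℕ k % 6 ≡ 1 ⊎ toℕ k % 6 ≡ 5 → ∀ j → C ≐ C₆ n j →
          TotalPerfectCode (GP n 3≤n k k≢0) C
  code₆ n%6 k%6 j C≐ with members (P₆ j) (Q₆ j) (u∈C₆ n%6 j) (v∈C₆ n%6 j) C≐
  ... | u∈C , v∈C = toTPC
    (λ f → ExactlyOne-map (at (toℕ j) u∈C f 1) (at (toℕ j) u∈C f (n ∸ 1)) (v∈C f)
      (proj₁ (alternate₆ j (toℕ f) 1 (n ∸ 1) (trans (cong (_% 6) 1+n-1) n%6) (inj₁ refl))))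
    (λ f → ExactlyOne-map (at (toℕ j + 3) v∈C f (toℕ k)) (at (toℕ j + 3) v∈C f (n ∸ toℕ k)) (u∈C f)
      (proj₂ (alternate₆ j (toℕ f) (toℕ k) (n ∸ toℕ k) (trans (cong (_% 6) k+n-k) n%6) k%6)))
    where
    at : ∀ c {P : Fin n → Set ℓ} → (∀ f → Adjacent₆ c (toℕ f) ⇔ P f) →
         ∀ f m → Adjacent₆ c (toℕ f + m) ⇔ P (f ⊕ m)
    at c {P} P⇔ f m =
      subst (λ r → (r ≡ c % 6 ⊎ r ≡ suc c % 6) ⇔ P (f ⊕ m)) (toℕ-mod-% n%6 (toℕ f + m)) (P⇔ (f ⊕ m))
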